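{- Let $\mathrm{Ax}\subseteq\{\mathsf{N},\mathsf{P},\mathsf{D},\mathsf{T}\}$. For every formula $\varphi\in\mathcal{L}$: if $\vdash_{\mathsf{IM}\oplus\mathrm{Ax}}\varphi$, then the sequent $\varphi^\circ$ is derivable in the calculus $\mathcal{C}_{\mathsf{IM}\oplus\mathrm{Ax}}$.
   Context: Language: $\mathcal{L}$ is generated by $\varphi ::= p \mid \bot \mid \varphi\wedge\varphi \mid \varphi\vee\varphi \mid \varphi\to\varphi \mid \Box\varphi \mid \Diamond\varphi$; $\neg\varphi := \varphi\to\bot$, $\top := \neg\bot$. Logics: $\mathsf{IM}$ is obtained by extending an axiomatisation of intuitionistic propositional logic over $\mathcal{L}$ with the rules "from $\varphi\to\psi$ infer $\Box\varphi\to\Box\psi$" and "from $\varphi\to\psi$ infer $\Diamond\varphi\to\Diamond\psi$" and the axioms $(\Box\varphi\wedge\Diamond\neg\varphi)\to\bot$ and $(\Box\top\to\Diamond\varphi)\to\Diamond\varphi$, closed under modus ponens and uniform substitution. $\mathsf{IM}\oplus\mathrm{Ax}$ additionally has the axioms in $\mathrm{Ax}$ (with the same closure), where $\mathsf{N}$ is $\Box\top$; $\mathsf{P}$ is $\Diamond\top$; $\mathsf{D}$ is $\Box\varphi\to\Diamond\varphi$; $\mathsf{T}$ is the conjunction of $\Box\varphi\to\varphi$ and $\varphi\to\Diamond\varphi$. Sequents: a marked formula is an input formula $\varphi^\bullet$ or an output formula $\varphi^\circ$ with $\varphi\in\mathcal{L}$. A block is $\{\Delta\}$ where $\Delta$ contains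 at most one marked formula; it is an input block if $\Delta=\varphi^\bullet$ or $\Delta$ is empty, and an output block if $\Delta=\varphi^\circ$. A sequent has the form $\Gamma=\Lambda,\Pi$ where $\Lambda$ is a finite multiset of input formulas and input blocks and $\Pi$ is empty, or one output formula $\varphi^\circ$, or one output block $\{\varphi^\circ\}$. Below $\Gamma$ ranges over sequents, $\Lambda$ over sequents with only input components, $|\Delta|$ is the number of formulas in $\Delta$, and all rule instances must consist of sequents. The output pruning $\Gamma^\downarrow$ is $\Gamma$ with its output formula (if any) removed; if the output formula is inside a block, the block is kept but emptied to $\{\ \}$ (so $\{\varphi^\bullet\}^\downarrow=\{\varphi^\bullet\}$, $\{\varphi^\circ\}^\downarrow=\{\ \}$). Rules of $\mathcal{C}_{\mathsf{IM}}$ (premisses / conclusion): $\bot^\bullet$: (no premiss) / $\Gamma,\bot^\bullet$. $\mathsf{id}$: (no premiss) / $\Lambda,p^\bullet,p^\circ$ ($p$ a proposition letter). $\wedge^\bullet$: $\Gamma,\varphi^\bullet,\psi^\bullet$ / $\Gamma,(\varphi\wedge\psi)^\bullet$. $\wedge^\circ$: $\Lambda,\varphi^\circ$ and $\Lambda,\psi^\circ$ / $\Lambda,(\varphi\wedge\psi)^\circ$. $\vee^\bullet$: $\Gamma,\varphi^\bullet$ and $\Gamma,\psi^\bullet$ / $\Gamma,(\varphi\vee\psi)^\bullet$. $\vee^\circ$: $\Lambda,\varphi^\circ$ / $\Lambda,(\varphi\vee\psi)^\circ$; and $\Lambda,\psi^\circ$ / $\Lambda,(\varphi\vee\psi)^\circ$.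 $\to^\bullet$: $\Gamma^\downarrow,(\varphi\to\psi)^\bullet,\varphi^\circ$ and $\Gamma,\psi^\bullet$ / $\Gamma,(\varphi\to\psi)^\bullet$. $\to^\circ$: $\Lambda,\varphi^\bullet,\psi^\circ$ / $\Lambda,(\varphi\to\psi)^\circ$. $\Box^\bullet$: $\Gamma,\{\varphi^\bullet\}$ / $\Gamma,(\Box\varphi)^\bullet$. $\Box^\circ$ ($|\Delta|\leq 1$): $\Delta,\varphi^\circ$ / $\Lambda,\{\Delta\},(\Box\varphi)^\circ$. $\Diamond^\bullet$ ($|\Delta|\leq 1$): $\varphi^\bullet,\Delta$ / $\Gamma,(\Diamond\varphi)^\bullet,\{\Delta\}$. $\Diamond^\circ$: $\Lambda,\{\varphi^\circ\}$ / $\Lambda,(\Diamond\varphi)^\circ$. $\mathcal{C}_{\mathsf{IM}\oplus\mathrm{Ax}}$ extends $\mathcal{C}_{\mathsf{IM}}$ with the rules corresponding to the axioms in $\mathrm{Ax}$ ($\mathsf{n}$ for $\mathsf{N}$, $\mathsf{p}$ for $\mathsf{P}$, $\mathsf{d}$ for $\mathsf{D}$, $\mathsf{t}$ for $\mathsf{T}$), and additionally with $\mathsf{p}$ if $\mathsf{D}\in\mathrm{Ax}$; here $\Delta,\Sigma$ consist of marked formulas with $|\Delta|=|\Sigma|=1$: $\mathsf{n}$: $\Gamma,\{\ \}$ / $\Gamma$. $\mathsf{p}$: $\Delta$ / $\Gamma,\{\Delta\}$. $\mathsf{d}$: $\Delta,\Sigma$ / $\Gamma,\{\Delta\},\{\Sigma\}$.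 $\mathsf{t}$: $\Gamma,\{\Delta\}^\downarrow,\Delta$ / $\Gamma,\{\Delta\}$. -}

module Defs where

open import Data.Empty using (⊥)
open import Data.List using (List; []; _∷_; _++_; map; fromMaybe)
open import Data.List.Relation.Binary.Permutation.Propositional using (_↭_)
open import Data.List.Relation.Unary.All using (All)
open import Data.Maybe using (Maybe; just; nothing)
import Data.Maybe.Relation.Unary.All as Maybe
open import Data.Nat using (ℕ)
open import Data.Product using (∃-syntax; _×_)
open import Data.Sum using (_⊎_)
open import Data.Unit using (⊤)
open import Level using (0ℓ)
open import Relation.Unary using (Pred; _∈_)

infix  30 _• _°
infix  25 □_ ◇_ ~_
infixr 23 _∧_
infixr 22 _∨_
infixr 20 _⇒_
infixl  8 _▸_
infix   9 _↓
infix   4 _⊢_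

data Formula : Set where
  var         : ℕ → Formula
  bot         : Formula
  _∧_ _∨_ _⇒_ : Formula → Formula → Formula
  □_ ◇_       : Formula → Formula

~_ : Formula → Formula
~ φ = φ ⇒ bot

top : Formula
top = ~ bot

_[_] : Formula → (ℕ → Formula) → Formula
var p   [ σ ] = σ p
bot     [ σ ] = bot
(φ ∧ ψ) [ σ ] = (φ [ σ ]) ∧ (ψ [ σ ])
(φ ∨ ψ) [ σ ] = (φ [ σ ]) ∨ (ψ [ σ ])
(φ ⇒ ψ) [ σ ] = (φ [ σ ]) ⇒ (ψ [ σ ])
(□ φ)   [ σ ] = □ (φ [ σ ])
(◇ φ)   [ σ ] = ◇ (φ [ σ ])

data Axiom : Set where
  N P D T : Axiom

data _⊢_ (Ax : Pred Axiom 0ℓ) : Formula → Set where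
  K       : ∀ {φ ψ}   → Ax ⊢ φ ⇒ ψ ⇒ φ
  S       : ∀ {φ ψ χ} → Ax ⊢ (φ ⇒ ψ ⇒ χ) ⇒ (φ ⇒ ψ) ⇒ φ ⇒ χ
  ∧-intro : ∀ {φ ψ}   → Ax ⊢ φ ⇒ ψ ⇒ φ ∧ ψ
  ∧-fst   : ∀ {φ ψ}   → Ax ⊢ φ ∧ ψ ⇒ φ
  ∧-snd   : ∀ {φ ψ}   → Ax ⊢ φ ∧ ψ ⇒ ψ
  ∨-inl   : ∀ {φ ψ}   → Ax ⊢ φ ⇒ φ ∨ ψ
  ∨-inr   : ∀ {φ ψ}   → Ax ⊢ ψ ⇒ φ ∨ ψ
  ∨-elim  : ∀ {φ ψ χ} → Ax ⊢ (φ ⇒ χ) ⇒ (ψ ⇒ χ) ⇒ φ ∨ ψ ⇒ χ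
  ⊥-elim  : ∀ {φ}     → Ax ⊢ bot ⇒ φ

  □◇-neg  : ∀ {φ} → Ax ⊢ (□ φ ∧ ◇ (~ φ)) ⇒ bot
  □◇-top  : ∀ {φ} → Ax ⊢ (□ top ⇒ ◇ φ) ⇒ ◇ φ

  axN     : N ∈ Ax → Ax ⊢ □ top
  axP     : P ∈ Ax → Ax ⊢ ◇ top
  axD     : ∀ {φ} → D ∈ Ax → Ax ⊢ □ φ ⇒ ◇ φ
  axT     : ∀ {φ} → T ∈ Ax → Ax ⊢ (□ φ ⇒ φ) ∧ (φ ⇒ ◇ φ)

  mp      : ∀ {φ ψ} → Ax ⊢ φ ⇒ ψ → Ax ⊢ φ → Ax ⊢ ψ
  □-mono  : ∀ {φ ψ} → Ax ⊢ φ ⇒ ψ → Ax ⊢ □ φ ⇒ □ ψ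
  ◇-mono  : ∀ {φ ψ} → Ax ⊢ φ ⇒ ψ → Ax ⊢ ◇ φ ⇒ ◇ ψ
  usub    : ∀ {φ} (σ : ℕ → Formula) → Ax ⊢ φ → Ax ⊢ φ [ σ ]

data Marked : Set where
  _• _° : Formula → Marked

-- The content of a block is at most one marked formula, so the side
-- condition |Δ| ≤ 1 is Δ : Maybe Marked, and |Δ| = 1 is Δ : Marked.
data Component : Set where
  ‹_› : Marked → Component
  ⟦_⟧ : Maybe Marked → Component

Input : Component → Set
Input ‹ φ • ›        = ⊤
Input ‹ φ ° ›        = ⊥
Input ⟦ nothing ⟧    = ⊤
Input ⟦ just (φ •) ⟧ = ⊤
Input ⟦ just (φ °) ⟧ = ⊥

Output : Component → Set
Output ‹ φ • ›        = ⊥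
Output ‹ φ ° ›        = ⊤
Output ⟦ nothing ⟧    = ⊥
Output ⟦ just (φ •) ⟧ = ⊥
Output ⟦ just (φ °) ⟧ = ⊤

-- Finite multisets of components: lists, considered up to _↭_.
Components : Set
Components = List Component

IsSequent : Components → Set
IsSequent Γ = ∃[ Λ ] ∃[ Π ]
  All Input Λ × Maybe.All Output Π × Γ ↭ Λ ++ fromMaybe Π

-- Γ ▸ c is "Γ , c".
pattern _▸_ Γ c = c ∷ Γ

contents : Maybe Marked → Components
contents Δ = map ‹_› (fromMaybe Δ)

_↓ : Components → Components
[] ↓                      = []
(Γ ▸ ‹ φ • ›) ↓           = Γ ↓ ▸ ‹ φ • ›
(Γ ▸ ‹ φ ° ›) ↓           = Γ ↓
(Γ ▸ ⟦ nothing ⟧) ↓       = Γ ↓ ▸ ⟦ nothing ⟧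
(Γ ▸ ⟦ just (φ •) ⟧) ↓    = Γ ↓ ▸ ⟦ just (φ •) ⟧
(Γ ▸ ⟦ just (φ °) ⟧) ↓    = Γ ↓ ▸ ⟦ nothing ⟧

-- Rule Ax Ps C: the rule schemes of the calculus for Ax, with list of
-- premisses Ps and conclusion C.  That all of these are sequents is
-- imposed in Derivable, which also forces each Γ below to be a sequent.
data Rule (Ax : Pred Axiom 0ℓ) : List Components → Components → Set where
  ⊥•  : ∀ {Γ} → Rule Ax [] (Γ ▸ ‹ bot • ›)
  id▹ : ∀ {Λ p} → All Input Λ →
        Rule Ax [] (Λ ▸ ‹ var p • › ▸ ‹ var p ° ›)
  ∧•  : ∀ {Γ φ ψ} →
        Rule Ax ((Γ ▸ ‹ φ • › ▸ ‹ ψ • ›) ∷ [])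
                (Γ ▸ ‹ (φ ∧ ψ) • ›)
  ∧°  : ∀ {Λ φ ψ} → All Input Λ →
        Rule Ax ((Λ ▸ ‹ φ ° ›) ∷ (Λ ▸ ‹ ψ ° ›) ∷ [])
                (Λ ▸ ‹ (φ ∧ ψ) ° ›)
  ∨•  : ∀ {Γ φ ψ} →
        Rule Ax ((Γ ▸ ‹ φ • ›) ∷ (Γ ▸ ‹ ψ • ›) ∷ [])
                (Γ ▸ ‹ (φ ∨ ψ) • ›)
  ∨°₁ : ∀ {Λ φ ψ} → All Input Λ →
        Rule Ax ((Λ ▸ ‹ φ ° ›) ∷ [])
                (Λ ▸ ‹ (φ ∨ ψ) ° ›)
  ∨°₂ : ∀ {Λ φ ψ} → All Input Λ →
        Rule Ax ((Λ ▸ ‹ ψ ° ›) ∷ [])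
                (Λ ▸ ‹ (φ ∨ ψ) ° ›)
  ⇒•  : ∀ {Γ φ ψ} →
        Rule Ax ((Γ ↓ ▸ ‹ (φ ⇒ ψ) • › ▸ ‹ φ ° ›) ∷ (Γ ▸ ‹ ψ • ›) ∷ [])
                (Γ ▸ ‹ (φ ⇒ ψ) • ›)
  ⇒°  : ∀ {Λ φ ψ} → All Input Λ →
        Rule Ax ((Λ ▸ ‹ φ • › ▸ ‹ ψ ° ›) ∷ [])
                (Λ ▸ ‹ (φ ⇒ ψ) ° ›)
  □•  : ∀ {Γ φ} →
        Rule Ax ((Γ ▸ ⟦ just (φ •) ⟧) ∷ [])
                (Γ ▸ ‹ (□ φ) • ›)
  □°  : ∀ {Λ φ} {Δ : Maybe Marked} → All Input Λ →
        Rule Ax ((contents Δ ▸ ‹ φ ° ›) ∷ [])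
                (Λ ▸ ⟦ Δ ⟧ ▸ ‹ (□ φ) ° ›)
  ◇•  : ∀ {Γ φ} {Δ : Maybe Marked} →
        Rule Ax ((contents Δ ▸ ‹ φ • ›) ∷ [])
                (Γ ▸ ‹ (◇ φ) • › ▸ ⟦ Δ ⟧)
  ◇°  : ∀ {Λ φ} → All Input Λ →
        Rule Ax ((Λ ▸ ⟦ just (φ °) ⟧) ∷ [])
                (Λ ▸ ‹ (◇ φ) ° ›)

  n▹  : ∀ {Γ} → N ∈ Ax →
        Rule Ax ((Γ ▸ ⟦ nothing ⟧) ∷ [])
                Γ
  p▹  : ∀ {Γ} {Δ : Marked} → P ∈ Ax ⊎ D ∈ Ax →
        Rule Ax (([] ▸ ‹ Δ ›) ∷ [])
                (Γ ▸ ⟦ just Δ ⟧)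
  d▹  : ∀ {Γ} {Δ Σ : Marked} → D ∈ Ax →
        Rule Ax (([] ▸ ‹ Δ › ▸ ‹ Σ ›) ∷ [])
                (Γ ▸ ⟦ just Δ ⟧ ▸ ⟦ just Σ ⟧)
  t▹  : ∀ {Γ} {Δ : Marked} → T ∈ Ax →
        Rule Ax ((([] ▸ ⟦ just Δ ⟧) ↓ ++ Γ ▸ ‹ Δ ›) ∷ [])
                (Γ ▸ ⟦ just Δ ⟧)

-- Sequents are multisets, hence C ↭ Γ; there is no other structural rule.
data Derivable (Ax : Pred Axiom 0ℓ) : Components → Set where
  infer : ∀ {Ps C Γ} → Rule Ax Ps C → All IsSequent Ps → IsSequent C →
          C ↭ Γ → All (Derivable Ax) Ps → Derivable Ax Γ

{-# OPTIONS --safe #-}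
-- Semantic cut elimination.  Worlds are lists of input components, ordered
-- by weakening and by inversion of the left rules.  Every formula denotes an
-- upward closed set of worlds that is also closed under the left rules; the
-- Hilbert axioms are valid in this model, the world φ• forces φ, and a world
-- Λ that forces φ satisfies Λ , φ° derivable.  Because inversion is part of
-- the order, neither contraction nor cut has to be shown admissible.
module Submission where

open import Defs
open import Level using (0ℓ)
open import Data.Empty using (⊥)
open import Data.List using (List; []; _∷_; _++_; map; fromMaybe)
open import Data.List.Properties using (++-assoc)
open import Data.List.Membership.Propositional using (_∈_)
open import Data.List.Membership.Propositional.Properties using (∈-∃++; ∈-++⁻)
open import Data.List.Relation.Binary.Permutation.Propositional
open import Data.List.Relation.Binary.Permutation.Propositional.Properties
  using (∈-resp-↭; ++⁺ˡ; ++⁺ʳ; shift; drop-∷; ∷↭∷ʳ; map⁺; ++-comm;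
         ++-identityʳ)
open import Data.List.Relation.Unary.All using (All; []; _∷_)
import Data.List.Relation.Unary.All as All
open import Data.List.Relation.Unary.Any using (here; there)
open import Data.Maybe using (Maybe; just; nothing)
import Data.Maybe as Maybe
import Data.Maybe.Relation.Unary.All as MaybeAll
open import Data.Nat using (ℕ)
open import Data.Product using (∃-syntax; _×_; _,_; proj₁; proj₂)
open import Data.Sum using (_⊎_; inj₁; inj₂)
open import Data.Unit using (⊤; tt)
open import Function using (_∘_)
open import Relation.Binary.PropositionalEquality
  using (_≡_; refl; sym; cong; cong₂; subst)
open import Relation.Nullary using (¬_; contradiction)
open import Relation.Unary using (Pred) renaming (_∈_ to _∈ₚ_)

-- Multisets as lists up to permutation

module _ {A : Set} where

  infix 4 _∋_

  _∋_ : List A → A → Set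
  Λ ∋ c = ∃[ Γ ] Λ ↭ c ∷ Γ

  ∈⇒∋ : ∀ {c : A} {Λ} → c ∈ Λ → Λ ∋ c
  ∈⇒∋ c∈Λ with ys , zs , refl ← ∈-∃++ c∈Λ = ys ++ zs , shift _ ys zs

  ∷-split : ∀ {c d : A} {Γ Θ} → c ∷ Γ ↭ d ∷ Θ →
            (c ≡ d × Γ ↭ Θ) ⊎ ∃[ Ψ ] Γ ↭ d ∷ Ψ × Θ ↭ c ∷ Ψ
  ∷-split p with ∈-resp-↭ p (here refl)
  ... | here refl = inj₁ (refl , drop-∷ p)
  ... | there c∈Θ with Ψ , q ← ∈⇒∋ c∈Θ =
    inj₂ (Ψ , drop-∷ (trans p (trans (prep _ q) (swap _ _ refl))) , q)

  ++-split : ∀ {c : A} {Γ} Λ {Ψ} → c ∷ Γ ↭ Λ ++ Ψ →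
             c ∈ Ψ ⊎ ∃[ Θ ] Λ ↭ c ∷ Θ × Γ ↭ Θ ++ Ψ
  ++-split Λ {Ψ} p with ∈-++⁻ Λ (∈-resp-↭ p (here refl))
  ... | inj₂ c∈Ψ = inj₁ c∈Ψ
  ... | inj₁ c∈Λ with Θ , q ← ∈⇒∋ c∈Λ =
    inj₂ (Θ , q , drop-∷ (trans p (++⁺ʳ Ψ q)))

-- Worlds and their order

data Item : Set where
  formula : Formula → Item
  block   : Maybe Formula → Item

World : Set
World = List Item

inner : Maybe Formula → World
inner Δ = map formula (fromMaybe Δ)

infix 4 _↝_ _⟶_ _≤_

-- c ↝ A: A replaces c in the last premiss, or one of the two premisses of
-- ∨•, of the left rule for c.
data _↝_ : Item → World → Set where
  ∧↝  : ∀ {φ ψ} → formula (φ ∧ ψ) ↝ formula ψ ∷ formula φ ∷ []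
  ∨↝₁ : ∀ {φ ψ} → formula (φ ∨ ψ) ↝ formula φ ∷ []
  ∨↝₂ : ∀ {φ ψ} → formula (φ ∨ ψ) ↝ formula ψ ∷ []
  ⇒↝  : ∀ {φ ψ} → formula (φ ⇒ ψ) ↝ formula ψ ∷ []
  □↝  : ∀ {φ}   → formula (□ φ) ↝ block (just φ) ∷ []

data _⟶_ (Λ Λ′ : World) : Set where
  weaken : ∀ {c} → Λ′ ↭ c ∷ Λ → Λ ⟶ Λ′
  invert : ∀ {c A Γ} → Λ ↭ c ∷ Γ → c ↝ A → Λ′ ↭ A ++ Γ → Λ ⟶ Λ′

data _≤_ (Λ : World) : World → Set where
  perm : ∀ {Λ′} → Λ ↭ Λ′ → Λ ≤ Λ′
  step : ∀ {Λ′ Λ″} → Λ ≤ Λ′ → Λ′ ⟶ Λ″ → Λ ≤ Λ″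

≤-refl : ∀ {Λ} → Λ ≤ Λ
≤-refl = perm refl

≤-↭ : ∀ {Λ Λ′ Λ″} → Λ ≤ Λ′ → Λ′ ↭ Λ″ → Λ ≤ Λ″
≤-↭ (perm p) q = perm (trans p q)
≤-↭ (step l (weaken p)) q = step l (weaken (trans (↭-sym q) p))
≤-↭ (step l (invert p r p′)) q = step l (invert p r (trans (↭-sym q) p′))

≤-trans : ∀ {Λ Λ′ Λ″} → Λ ≤ Λ′ → Λ′ ≤ Λ″ → Λ ≤ Λ″
≤-trans l (perm p)   = ≤-↭ l p
≤-trans l (step m s) = step (≤-trans l m) s

≤-∷ : ∀ {c Λ} → Λ ≤ c ∷ Λ
≤-∷ = step ≤-refl (weaken refl)

≤-++ˡ : ∀ A {Λ} → Λ ≤ A ++ Λ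
≤-++ˡ []      = ≤-refl
≤-++ˡ (c ∷ A) = ≤-trans (≤-++ˡ A) ≤-∷

[]≤ : ∀ {Λ} → [] ≤ Λ
[]≤ {Λ} = ≤-trans (≤-++ˡ Λ) (perm (++-identityʳ Λ))

≤-invert : ∀ {c A Γ Λ} → Λ ↭ c ∷ Γ → c ↝ A → Λ ≤ A ++ Γ
≤-invert p r = step ≤-refl (invert p r refl)

∷-mono : ∀ c {Λ Λ′} → Λ ≤ Λ′ → c ∷ Λ ≤ c ∷ Λ′
∷-mono c (perm p) = perm (prep c p)
∷-mono c (step l (weaken p)) =
  step (∷-mono c l) (weaken (trans (prep c p) (swap _ _ refl)))
∷-mono c (step l (invert {A = A} p r q)) =
  step (∷-mono c l)
    (invert (trans (prep c p) (swap _ _ refl)) r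
      (trans (prep c q) (↭-sym (shift c A _))))

++-mono : ∀ A {Λ Λ′} → Λ ≤ Λ′ → A ++ Λ ≤ A ++ Λ′
++-mono []      l = l
++-mono (c ∷ A) l = ∷-mono c (++-mono A l)

-- Follow one occurrence of `c` through the steps. Either no step inverts it, or the step that does
-- can be moved to the front and the earlier steps replayed beside `A`.
≤-split : ∀ {c Γ Λ} → c ∷ Γ ≤ Λ →
          (∃[ Γ′ ] Λ ↭ c ∷ Γ′ × Γ ≤ Γ′) ⊎ (∃[ A ] c ↝ A × A ++ Γ ≤ Λ)
≤-split (perm p) = inj₁ (_ , ↭-sym p , ≤-refl)
≤-split (step l s) with ≤-split l
... | inj₂ (A , r , m) = inj₂ (A , r , step m s)
≤-split (step l (weaken q)) | inj₁ (Γ′ , p , m) =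
  inj₁ (_ , trans q (trans (prep _ p) (swap _ _ refl)) , step m (weaken refl))
≤-split (step l (invert {A = A} q r q′)) | inj₁ (Γ′ , p , m)
  with ∷-split (trans (↭-sym p) q)
... | inj₁ (refl , e) =
  inj₂ (A , r , ≤-↭ (++-mono A m) (trans (++⁺ˡ A e) (↭-sym q′)))
... | inj₂ (Ψ , e , e′) =
  inj₁ (A ++ Ψ , trans q′ (trans (++⁺ˡ A e′) (shift _ A Ψ)) ,
        step m (invert e r refl))

-- Meant for blocks, proposition letters and ◇-formulas, which no step inverts.
persist : ∀ {c Γ Λ Λ′} → (∀ {A} → ¬ (c ↝ A)) → Λ ↭ c ∷ Γ → Λ ≤ Λ′ →
          ∃[ Γ′ ] Λ′ ↭ c ∷ Γ′ × Γ ≤ Γ′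
persist ¬r p l with ≤-split (≤-trans (perm (↭-sym p)) l)
... | inj₁ q           = q
... | inj₂ (_ , r , _) = contradiction r ¬r

¬block↝ : ∀ {Δ A} → ¬ (block Δ ↝ A)
¬block↝ ()

∋-block-up : ∀ {Δ Λ Λ′} → Λ ≤ Λ′ → Λ ∋ block Δ → Λ′ ∋ block Δ
∋-block-up l (_ , p) with Γ′ , q , _ ← persist ¬block↝ p l = Γ′ , q

-- Sequents of worlds, and pruning

data Out : Set where
  none    : Out
  form    : Formula → Out
  blocked : Formula → Out

component : Item → Component
component (formula φ) = ‹ φ • ›
component (block Δ)   = ⟦ Maybe.map _• Δ ⟧

output : Out → Maybe Component
output none        = nothing
output (form φ)    = just ‹ φ ° ›
output (blocked φ) = just ⟦ just (φ °) ⟧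

sequent : World → Out → Components
sequent Λ Π = map component Λ ++ fromMaybe (output Π)

inputs : ∀ Λ → All Input (map component Λ)
inputs []                   = []
inputs (formula φ ∷ Λ)      = tt ∷ inputs Λ
inputs (block nothing ∷ Λ)  = tt ∷ inputs Λ
inputs (block (just φ) ∷ Λ) = tt ∷ inputs Λ

sequent-isSequent : ∀ Λ Π → IsSequent (sequent Λ Π)
sequent-isSequent Λ Π =
  map component Λ , output Π , inputs Λ , outputs Π , refl
  where
  outputs : ∀ Π → MaybeAll.All Output (output Π)
  outputs none        = MaybeAll.nothing
  outputs (form φ)    = MaybeAll.just tt
  outputs (blocked φ) = MaybeAll.just tt

sequent-↭ : ∀ {Λ Λ′} Π → Λ ↭ Λ′ → sequent Λ Π ↭ sequent Λ′ Π
sequent-↭ Π p = ++⁺ʳ _ (map⁺ component p)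

sequent-form : ∀ Λ φ → ‹ φ ° › ∷ map component Λ ↭ sequent Λ (form φ)
sequent-form Λ φ = ∷↭∷ʳ _ (map component Λ)

sequent-blocked : ∀ Λ φ →
                  ⟦ just (φ °) ⟧ ∷ map component Λ ↭ sequent Λ (blocked φ)
sequent-blocked Λ φ = ∷↭∷ʳ _ (map component Λ)

-- What the pruning of the output leaves behind.
ghost : Out → World
ghost none        = []
ghost (form φ)    = []
ghost (blocked φ) = block nothing ∷ []

sequent-↓ : ∀ Λ Π → sequent Λ Π ↓ ≡ map component (Λ ++ ghost Π)
sequent-↓ [] none                = refl
sequent-↓ [] (form φ)            = refl
sequent-↓ [] (blocked φ)         = refl
sequent-↓ (formula φ ∷ Λ) Π      = cong (‹ φ • › ∷_) (sequent-↓ Λ Π)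
sequent-↓ (block nothing ∷ Λ) Π  = cong (⟦ nothing ⟧ ∷_) (sequent-↓ Λ Π)
sequent-↓ (block (just φ) ∷ Λ) Π = cong (⟦ just (φ •) ⟧ ∷_) (sequent-↓ Λ Π)

∈-ghost : ∀ {c} Π → c ∈ ghost Π → c ≡ block nothing × ∃[ χ ] Π ≡ blocked χ
∈-ghost (blocked χ) (here refl) = refl , χ , refl

-- The ghost holds at most an empty block, so any other item comes from `Λ₀`.
keep : ∀ {c Γ Λ Λ₀} Π → ¬ (c ≡ block nothing) →
       Λ ↭ c ∷ Γ → Λ ↭ Λ₀ ++ ghost Π →
       ∃[ Γ₀ ] Λ₀ ↭ c ∷ Γ₀ × Γ ↭ Γ₀ ++ ghost Π
keep {Λ₀ = Λ₀} Π c≢ p q with ++-split Λ₀ (trans (↭-sym p) q)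
... | inj₂ r = r
... | inj₁ c∈ = contradiction (proj₁ (∈-ghost Π c∈)) c≢

-- Closure under the left rules

module Model (Ax : Pred Axiom 0ℓ) where

  Derives : World → Out → Set
  Derives Λ Π = Derivable Ax (sequent Λ Π)

  derivable-resp-↭ : ∀ {Γ Γ′} → Γ ↭ Γ′ → Derivable Ax Γ → Derivable Ax Γ′
  derivable-resp-↭ p (infer r ss s q ds) = infer r ss s (trans q p) ds

  isSequent-resp-↭ : ∀ {Γ Γ′} → Γ ↭ Γ′ → IsSequent Γ → IsSequent Γ′
  isSequent-resp-↭ p (Λ , Π , i , o , q) =
    Λ , Π , i , o , trans (↭-sym p) q

  derivable⇒isSequent : ∀ {Γ} → Derivable Ax Γ → IsSequent Γ
  derivable⇒isSequent (infer _ _ s p _) = isSequent-resp-↭ p s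

  by : ∀ {Ps C} Λ Π → Rule Ax Ps C → C ↭ sequent Λ Π →
       All (Derivable Ax) Ps → Derives Λ Π
  by Λ Π r p ds =
    infer r (All.map derivable⇒isSequent ds)
      (isSequent-resp-↭ (↭-sym p) (sequent-isSequent Λ Π)) p ds

  derives-resp-↭ : ∀ {Λ Λ′ Π} → Λ ↭ Λ′ → Derives Λ Π → Derives Λ′ Π
  derives-resp-↭ {Π = Π} p = derivable-resp-↭ (sequent-↭ Π p)

  derives-form : ∀ {Λ φ} → Derives Λ (form φ) →
                 Derivable Ax (‹ φ ° › ∷ map component Λ)
  derives-form {Λ} {φ} = derivable-resp-↭ (↭-sym (sequent-form Λ φ))

  derives-blocked : ∀ {Λ φ} → Derives Λ (blocked φ) →
                    Derivable Ax (⟦ just (φ °) ⟧ ∷ map component Λ)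
  derives-blocked {Λ} {φ} = derivable-resp-↭ (↭-sym (sequent-blocked Λ φ))

  -- The premiss without the output Π; of the rules listed here only ⇒• has one.
  data Side (Λ : World) : Item → Set where
    side-bot : Side Λ (formula bot)
    side-∧   : ∀ {φ ψ} → Side Λ (formula (φ ∧ ψ))
    side-∨   : ∀ {φ ψ} → Side Λ (formula (φ ∨ ψ))
    side-⇒   : ∀ {φ ψ} → (∀ {Λ′} → Λ ≤ Λ′ → Derives Λ′ (form φ)) →
               Side Λ (formula (φ ⇒ ψ))
    side-□   : ∀ {φ} → Side Λ (formula (□ φ))

  data Grow (Λ : World) : Item → Set where
    grow-n : N ∈ₚ Ax → Grow Λ (block nothing)
    grow-t : ∀ {φ} → T ∈ₚ Ax → Λ ∋ block (just φ) → Grow Λ (formula φ)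

  data Absurd (Λ : World) : Set where
    absurd-◇ : ∀ {φ Δ Γ} → Λ ↭ formula (◇ φ) ∷ block Δ ∷ Γ →
               (∀ Π → Derives (formula φ ∷ inner Δ) Π) → Absurd Λ
    absurd-p : ∀ {φ} → P ∈ₚ Ax ⊎ D ∈ₚ Ax → Λ ∋ block (just φ) →
               Derives (formula φ ∷ []) none → Absurd Λ
    absurd-d : ∀ {φ ψ Γ} → D ∈ₚ Ax →
               Λ ↭ block (just φ) ∷ block (just ψ) ∷ Γ →
               Derives (formula φ ∷ formula ψ ∷ []) none → Absurd Λ

  -- Closure of X under the left rules.  The constructor unfold covers ⊥•
  -- (no A with c ↝ A), ∧•, ∨•, ⇒• and □•; expand covers n and t with an
  -- input block; absurd covers ◇•, p and d, whose premisses discard Γ.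
  data Closure (X : World → Set) (Λ : World) : Set where
    base   : X Λ → Closure X Λ
    unfold : ∀ {c Γ} → Λ ↭ c ∷ Γ → Side Λ c →
             (∀ {A} → c ↝ A → Closure X (A ++ Γ)) → Closure X Λ
    expand : ∀ {c} → Grow Λ c → Closure X (c ∷ Λ) → Closure X Λ
    absurd : Absurd Λ → Closure X Λ

  Up : (World → Set) → Set
  Up X = ∀ {Λ Λ′} → Λ ≤ Λ′ → X Λ → X Λ′

  ∅ : World → Set
  ∅ _ = ⊥

  -- `side-⇒` asks for its premiss at all larger worlds, so transitivity suffices and no derivation
  -- has to be weakened or inverted.
  side-up : ∀ {c} → Up (λ Λ → Side Λ c)
  side-up l side-bot   = side-bot
  side-up l side-∧     = side-∧
  side-up l side-∨     = side-∨
  side-up l (side-⇒ d) = side-⇒ (λ m → d (≤-trans l m))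
  side-up l side-□     = side-□

  grow-up : ∀ {c} → Up (λ Λ → Grow Λ c)
  grow-up l (grow-n n)   = grow-n n
  grow-up l (grow-t t b) = grow-t t (∋-block-up l b)

  absurd-up : Up Absurd
  absurd-up l (absurd-◇ p d)
    with _ , q , m ← persist (λ ()) p l
    with _ , q′ , _ ← persist ¬block↝ refl m =
    absurd-◇ (trans q (prep _ q′)) d
  absurd-up l (absurd-p a b d) = absurd-p a (∋-block-up l b) d
  absurd-up l (absurd-d a p d)
    with _ , q , m ← persist ¬block↝ p l
    with _ , q′ , _ ← persist ¬block↝ refl m =
    absurd-d a (trans q (prep _ q′)) d

  closure-up : ∀ {X} → Up X → Up (Closure X)
  closure-up up l (base x) = base (up l x)
  closure-up up l (unfold p s f) with ≤-split (≤-trans (perm (↭-sym p)) l)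
  ... | inj₁ (_ , q , m) =
    unfold q (side-up l s) (λ {A} r → closure-up up (++-mono A m) (f r))
  -- The larger world has already inverted `c`: continue in the matching premiss and drop the rule.
  ... | inj₂ (_ , r , m) = closure-up up m (f r)
  closure-up up l (expand g x) =
    expand (grow-up l g) (closure-up up (∷-mono _ l) x)
  closure-up up l (absurd a) = absurd (absurd-up l a)

  -- A bind with strength: `y` is carried to the leaves. Premisses of `unfold` lie above its
  -- conclusion because inversions are steps of the order.
  closure-bind : ∀ {X Y Z} → Up Y → (∀ {Λ} → Y Λ → X Λ → Closure Z Λ) →
                 ∀ {Λ} → Y Λ → Closure X Λ → Closure Z Λ
  closure-bind up h y (base x)       = h y x
  closure-bind up h y (unfold p s f) =
    unfold p s (λ r → closure-bind up h (up (≤-invert p r) y) (f r))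
  closure-bind up h y (expand g x)   =
    expand g (closure-bind up h (up ≤-∷ y) x)
  closure-bind up h y (absurd a)     = absurd a

  closure-join : ∀ {X Z} → (∀ {Λ} → X Λ → Closure Z Λ) →
                 ∀ {Λ} → Closure X Λ → Closure Z Λ
  closure-join h = closure-bind {Y = λ _ → ⊤} (λ _ _ → tt) (λ _ → h) tt

  ∅-up : Up (Closure ∅)
  ∅-up = closure-up (λ _ ())

  ∅-elim : ∀ {X Λ} → Closure ∅ Λ → Closure X Λ
  ∅-elim = closure-join λ ()

  -- From closures to derivations

  unfold-derives : ∀ {c Γ Γ₀ Λ Λ₀} Π → Side Λ c →
                   Λ ↭ c ∷ Γ → Λ₀ ↭ c ∷ Γ₀ → Γ ↭ Γ₀ ++ ghost Π →
                   (∀ {A} → c ↝ A → Derives (A ++ Γ₀) Π) → Derives Λ₀ Π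
  unfold-derives {Λ₀ = Λ₀} Π side-bot p q e f =
    by Λ₀ Π ⊥• (sequent-↭ Π (↭-sym q)) []
  unfold-derives {Λ₀ = Λ₀} Π side-∧ p q e f =
    by Λ₀ Π ∧• (sequent-↭ Π (↭-sym q)) (f ∧↝ ∷ [])
  unfold-derives {Λ₀ = Λ₀} Π side-∨ p q e f =
    by Λ₀ Π ∨• (sequent-↭ Π (↭-sym q)) (f ∨↝₁ ∷ f ∨↝₂ ∷ [])
  unfold-derives {Γ₀ = Γ₀} {Λ₀ = Λ₀} Π (side-⇒ {φ} {ψ} d) p q e f =
    by Λ₀ Π ⇒• (sequent-↭ Π (↭-sym q))
      -- Pruning leaves `Γ₀` with the ghost, that is `Γ`, so the side premiss is taken at a
      -- permutation of `Λ`.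
      (subst (λ Ψ → Derivable Ax (Ψ ▸ ‹ (φ ⇒ ψ) • › ▸ ‹ φ ° ›))
         (sym (sequent-↓ Γ₀ Π))
         (derives-form (d (perm (trans p (prep _ e)))))
       ∷ f ⇒↝ ∷ [])
  unfold-derives {Λ₀ = Λ₀} Π side-□ p q e f =
    by Λ₀ Π □• (sequent-↭ Π (↭-sym q)) (f □↝ ∷ [])

  side≢block : ∀ {Λ c Δ} → Side Λ c → ¬ (c ≡ block Δ)
  side≢block () refl

  ◇-blocked : ∀ {φ χ Γ Λ} → Λ ↭ formula (◇ φ) ∷ Γ →
              Derives (formula φ ∷ []) (form χ) → Derives Λ (blocked χ)
  ◇-blocked {φ} {χ} {Γ} {Λ} p d =
    by Λ (blocked χ) (◇• {Γ = map component Γ} {Δ = just (χ °)})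
      (trans (sequent-blocked (formula (◇ φ) ∷ Γ) χ)
             (sequent-↭ (blocked χ) (↭-sym p)))
      (d ∷ [])

  ◇-derives : ∀ {φ Γ Λ} Δ Π → Λ ↭ formula (◇ φ) ∷ block Δ ∷ Γ →
              Derives (formula φ ∷ inner Δ) none → Derives Λ Π
  ◇-derives {Λ = Λ} nothing Π p d =
    by Λ Π (◇• {Δ = nothing})
      (sequent-↭ Π (trans (swap _ _ refl) (↭-sym p))) (d ∷ [])
  ◇-derives {Λ = Λ} (just ψ) Π p d =
    by Λ Π (◇• {Δ = just (ψ •)})
      (sequent-↭ Π (trans (swap _ _ refl) (↭-sym p))) (d ∷ [])

  absurd-derives : ∀ {Λ Λ₀} Π → Λ ↭ Λ₀ ++ ghost Π → Absurd Λ → Derives Λ₀ Π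
  absurd-derives Π q (absurd-◇ {Δ = Δ} p d)
    with Γ₀ , p₀ , e ← keep Π (λ ()) p q
    with ++-split Γ₀ e
  ... | inj₂ (_ , e′ , _) = ◇-derives Δ Π (trans p₀ (prep _ e′)) (d none)
  -- The partner of ◇φ is the ghost, which stands for the output block {χ°}. Rule ◇• then needs a
  -- premiss with output χ, which is why `absurd-◇` quantifies over `Π`.
  ... | inj₁ b with refl , χ , refl ← ∈-ghost Π b = ◇-blocked p₀ (d (form χ))
  absurd-derives {Λ₀ = Λ₀} Π q (absurd-p a (_ , p) d)
    with Γ₀ , p₀ , _ ← keep Π (λ ()) p q =
    by Λ₀ Π (p▹ a) (sequent-↭ Π (↭-sym p₀)) (d ∷ [])
  absurd-derives {Λ₀ = Λ₀} Π q (absurd-d a p d)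
    with Γ₀ , p₀ , e ← keep Π (λ ()) p q
    with Γ₁ , p₁ , _ ← keep Π (λ ()) refl e =
    by Λ₀ Π (d▹ a)
      (sequent-↭ Π (↭-sym (trans p₀ (prep _ p₁)))) (d ∷ [])

  -- A world Λ₀ , { } accounts for the sequent Λ₀ , {χ°}: pruning the latter
  -- in the left premiss of ⇒• yields exactly that world.
  closure-derives : ∀ {X} Π → Up X →
                    (∀ {Λ₀} → X (Λ₀ ++ ghost Π) → Derives Λ₀ Π) →
                    ∀ {Λ Λ₀} → Λ ↭ Λ₀ ++ ghost Π → Closure X Λ → Derives Λ₀ Π
  closure-derives Π up h q (base x) = h (up (perm q) x)
  closure-derives Π up h q (unfold p s f)
    with Γ₀ , p₀ , e ← keep Π (side≢block s) p q =
    unfold-derives Π s p p₀ e λ {A} r →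
      closure-derives Π up h
        (trans (++⁺ˡ A e) (↭-reflexive (sym (++-assoc A Γ₀ (ghost Π))))) (f r)
  closure-derives Π up h {Λ₀ = Λ₀} q (expand (grow-n n) x) =
    by Λ₀ Π (n▹ n) refl (closure-derives Π up h (prep _ q) x ∷ [])
  closure-derives Π up h {Λ₀ = Λ₀} q (expand (grow-t t (_ , p)) x)
    with Γ₀ , p₀ , _ ← keep Π (λ ()) p q =
    by Λ₀ Π (t▹ t) (sequent-↭ Π (↭-sym p₀))
      (derivable-resp-↭ (trans (sequent-↭ Π (prep _ p₀)) (swap _ _ refl))
         (closure-derives Π up h (prep _ q) x) ∷ [])
  closure-derives Π up h q (absurd a) = absurd-derives Π q a

  closure-derives-form : ∀ {X φ} → Up X →
                         (∀ Λ → X Λ → Derives Λ (form φ)) →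
                         ∀ {Λ} → Closure X Λ → Derives Λ (form φ)
  closure-derives-form {X} {φ} up h {Λ} =
    closure-derives (form φ) up
      (λ {Λ₀} → h Λ₀ ∘ up (perm (++-identityʳ Λ₀))) (↭-sym (++-identityʳ Λ))

  ∅-derives : ∀ {Λ} Π → Closure ∅ Λ → Derives Λ Π
  ∅-derives {Λ} Π x =
    closure-derives Π (λ _ ()) (λ ()) refl (∅-up ≤-++ʳ x)
    where
    ≤-++ʳ : Λ ≤ Λ ++ ghost Π
    ≤-++ʳ = ≤-trans (≤-++ˡ (ghost Π)) (perm (++-comm (ghost Π) Λ))

  -- Interpretation of formulas

  Implies : (X Y : World → Set) → World → Set
  Implies X Y Λ = ∀ {Λ′} → Λ ≤ Λ′ → X Λ′ → Y Λ′

  -- Neighbourhood semantics, with blocks as neighbourhoods: the content of a block is read as a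
  -- world of its own, as in the premiss of □°.
  Box : (World → Set) → World → Set
  Box X Λ = ∃[ Δ ] Λ ∋ block Δ × X (inner Δ)

  Entails : (World → Set) → Formula → Set
  Entails X χ = ∀ {Θ} → X Θ → Derives Θ (form χ)

  Excludes : (World → Set) → Maybe Formula → Set
  Excludes X Δ = ∀ {Θ} → inner Δ ≤ Θ → X Θ → Closure ∅ Θ

  -- ◇φ is described by the blocks it may interact with: replacing an empty
  -- block by {χ°} whenever φ entails χ, and inconsistency with any input block
  -- whose content excludes φ.  Demanding an empty block for the first makes
  -- (□⊤ → ◇φ) → ◇φ valid, since □⊤ holds in every world with a block.  In the
  -- second, Excludes asks for a Θ above Δ rather than for a disjoint union
  -- Δ , Θ; with the latter, axiom D would need contraction.
  record Dia (X : World → Set) (Λ : World) : Set where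
    field
      toOutput : ∀ {χ Λ′ Λ₀} → Λ ≤ Λ′ → Λ′ ↭ Λ₀ ++ block nothing ∷ [] →
                 Entails X χ → Derives Λ₀ (blocked χ)
      toInput  : ∀ {Δ Λ′} → Λ ≤ Λ′ → Λ′ ∋ block Δ →
                 Excludes X Δ → Closure ∅ Λ′

  open Dia

  -- `Closure` is inserted only where closedness under the left rules is not inherited; ∧, ⇒ and ◇
  -- get it from their parts or from the form of `Dia`.
  ⟦_⟧ᶠ : Formula → World → Set
  ⟦ var p ⟧ᶠ = Closure (_∋ formula (var p))
  ⟦ bot ⟧ᶠ   = Closure ∅
  ⟦ φ ∧ ψ ⟧ᶠ = λ Λ → ⟦ φ ⟧ᶠ Λ × ⟦ ψ ⟧ᶠ Λ
  ⟦ φ ∨ ψ ⟧ᶠ = Closure (λ Λ → ⟦ φ ⟧ᶠ Λ ⊎ ⟦ ψ ⟧ᶠ Λ)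
  ⟦ φ ⇒ ψ ⟧ᶠ = Implies ⟦ φ ⟧ᶠ ⟦ ψ ⟧ᶠ
  ⟦ □ φ ⟧ᶠ   = Closure (Box ⟦ φ ⟧ᶠ)
  ⟦ ◇ φ ⟧ᶠ   = Dia ⟦ φ ⟧ᶠ

  var-up : ∀ {p} → Up (_∋ formula (var p))
  var-up l (_ , p) with Γ , q , _ ← persist (λ ()) p l = Γ , q

  box-up : ∀ {X} → Up (Box X)
  box-up l (Δ , b , x) = Δ , ∋-block-up l b , x

  dia-up : ∀ {X} → Up (Dia X)
  dia-up l d .toOutput m = d .toOutput (≤-trans l m)
  dia-up l d .toInput m  = d .toInput (≤-trans l m)

  ⟦⟧-up : ∀ φ → Up ⟦ φ ⟧ᶠ
  ∨-up  : ∀ φ ψ → Up (λ Λ → ⟦ φ ⟧ᶠ Λ ⊎ ⟦ ψ ⟧ᶠ Λ)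

  ⟦⟧-up (var p)           = closure-up var-up
  ⟦⟧-up bot               = ∅-up
  ⟦⟧-up (φ ∧ ψ) l (x , y) = ⟦⟧-up φ l x , ⟦⟧-up ψ l y
  ⟦⟧-up (φ ∨ ψ)           = closure-up (∨-up φ ψ)
  ⟦⟧-up (φ ⇒ ψ) l f m     = f (≤-trans l m)
  ⟦⟧-up (□ φ)             = closure-up (box-up {⟦ φ ⟧ᶠ})
  ⟦⟧-up (◇ φ)             = dia-up

  ∨-up φ ψ l (inj₁ x) = inj₁ (⟦⟧-up φ l x)
  ∨-up φ ψ l (inj₂ y) = inj₂ (⟦⟧-up ψ l y)

  ⟦⟧-closed : ∀ φ {Λ} → Closure ⟦ φ ⟧ᶠ Λ → ⟦ φ ⟧ᶠ Λ
  ⟦⟧-closed (var p) = closure-join (λ x → x)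
  ⟦⟧-closed bot     = closure-join (λ x → x)
  ⟦⟧-closed (φ ∧ ψ) x =
    ⟦⟧-closed φ (closure-join (base ∘ proj₁) x) ,
    ⟦⟧-closed ψ (closure-join (base ∘ proj₂) x)
  ⟦⟧-closed (φ ∨ ψ) = closure-join (λ x → x)
  ⟦⟧-closed (φ ⇒ ψ) x l y =
    ⟦⟧-closed ψ
      (closure-bind (⟦⟧-up φ) (λ z f → base (f ≤-refl z)) y
        (closure-up (⟦⟧-up (φ ⇒ ψ)) l x))
  ⟦⟧-closed (□ φ) = closure-join (λ x → x)
  -- `toOutput` yields a derivation rather than a closure, so the left rules are applied in the
  -- calculus itself.
  ⟦⟧-closed (◇ φ) x .toOutput {χ} l p h =
    closure-derives (blocked χ) dia-up (λ d → d .toOutput ≤-refl refl h) p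
      (closure-up dia-up l x)
  ⟦⟧-closed (◇ φ) x .toInput l b h =
    closure-bind ∋-block-up (λ b′ d → d .toInput ≤-refl b′ h) b
      (closure-up dia-up l x)

  -- Reification and reflection

  -- Simultaneous induction on φ, as in normalisation by evaluation: at an implication each of the
  -- two calls the other on the antecedent.
  reify   : ∀ φ {Λ} → ⟦ φ ⟧ᶠ Λ → Derives Λ (form φ)
  reflect : ∀ φ {Λ} → Λ ∋ formula φ → ⟦ φ ⟧ᶠ Λ

  reify (var p) = closure-derives-form var-up λ Λ (Γ , q) →
    by Λ (form (var p)) (id▹ (inputs Γ))
      (trans (sequent-form (formula (var p) ∷ Γ) (var p))
             (sequent-↭ (form (var p)) (↭-sym q)))
      []
  reify bot = ∅-derives (form bot)
  reify (φ ∧ ψ) {Λ} (x , y) =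
    by Λ (form (φ ∧ ψ)) (∧° (inputs Λ)) (sequent-form Λ (φ ∧ ψ))
      (derives-form (reify φ x) ∷ derives-form (reify ψ y) ∷ [])
  reify (φ ∨ ψ) = closure-derives-form (∨-up φ ψ) λ where
    Λ (inj₁ x) → by Λ (form (φ ∨ ψ)) (∨°₁ (inputs Λ))
                   (sequent-form Λ (φ ∨ ψ)) (derives-form (reify φ x) ∷ [])
    Λ (inj₂ y) → by Λ (form (φ ∨ ψ)) (∨°₂ (inputs Λ))
                   (sequent-form Λ (φ ∨ ψ)) (derives-form (reify ψ y) ∷ [])
  reify (φ ⇒ ψ) {Λ} f =
    by Λ (form (φ ⇒ ψ)) (⇒° (inputs Λ)) (sequent-form Λ (φ ⇒ ψ))
      (derives-form (reify ψ (f ≤-∷ (reflect φ (Λ , refl)))) ∷ [])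
  reify (□ φ) = closure-derives-form (box-up {⟦ φ ⟧ᶠ}) λ where
    Λ (nothing , (Γ , p) , x) →
      by Λ (form (□ φ)) (□° {Δ = nothing} (inputs Γ))
        (trans (sequent-form (block nothing ∷ Γ) (□ φ))
               (sequent-↭ (form (□ φ)) (↭-sym p)))
        (derives-form {[]} (reify φ x) ∷ [])
    Λ (just ψ , (Γ , p) , x) →
      by Λ (form (□ φ)) (□° {Δ = just (ψ •)} (inputs Γ))
        (trans (sequent-form (block (just ψ) ∷ Γ) (□ φ))
               (sequent-↭ (form (□ φ)) (↭-sym p)))
        (derives-form {formula ψ ∷ []} (reify φ x) ∷ [])
  reify (◇ φ) {Λ} d =
    by Λ (form (◇ φ)) (◇° (inputs Λ)) (sequent-form Λ (◇ φ))
      -- The added empty block is the ghost of {φ°}.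
      (derives-blocked (d .toOutput ≤-∷ (∷↭∷ʳ _ Λ) (reify φ)) ∷ [])

  reflect (var p) b = base b
  reflect bot (_ , p) = unfold p side-bot λ ()
  reflect (φ ∧ ψ) (Γ , p) =
    ⟦⟧-closed φ (unfold p side-∧
      λ { ∧↝ → base (reflect φ (_ , swap _ _ refl)) }) ,
    ⟦⟧-closed ψ (unfold p side-∧
      λ { ∧↝ → base (reflect ψ (_ , refl)) })
  reflect (φ ∨ ψ) (Γ , p) = unfold p side-∨ λ where
    ∨↝₁ → base (inj₁ (reflect φ (Γ , refl)))
    ∨↝₂ → base (inj₂ (reflect ψ (Γ , refl)))
  reflect (φ ⇒ ψ) (Γ , p) l x with ≤-split (≤-trans (perm (↭-sym p)) l)
  ... | inj₁ (Γ′ , q , _) =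
    ⟦⟧-closed ψ (unfold q (side-⇒ (λ m → reify φ (⟦⟧-up φ m x)))
      λ { ⇒↝ → base (reflect ψ (Γ′ , refl)) })
  -- On the way up the implication was already replaced by ψ.
  ... | inj₂ (_ , ⇒↝ , m) = ⟦⟧-up ψ m (reflect ψ (Γ , refl))
  reflect (□ φ) (Γ , p) = unfold p side-□
    λ { □↝ → base (just φ , (Γ , refl) , reflect φ ([] , refl)) }
  reflect (◇ φ) (Γ , p) .toOutput {χ} l q h
    with _ , p′ , _ ← persist (λ ()) p l
    with _ , p₀ , _ ← keep (blocked χ) (λ ()) p′ q =
    ◇-blocked p₀ (h (reflect φ ([] , refl)))
  reflect (◇ φ) (Γ , p) .toInput {Δ} l (_ , b) h
    with _ , p′ , _ ← persist (λ ()) p l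
    with inj₂ (_ , q , _) ← ∷-split (trans (↭-sym p′) b) =
    -- The premiss of ◇• is the world of φ and the content of Δ. It forces φ and lies above that
    -- content, so `Excludes` makes it inconsistent.
    absurd (absurd-◇ (trans p′ (prep _ q)) λ Π →
      ∅-derives Π (h ≤-∷ (reflect φ (_ , refl))))

  -- Validity of the modal axioms

  -- For a filled block this is rule p. An empty block has the least world as its content, whose
  -- inconsistency spreads upwards.
  p-inner : P ∈ₚ Ax ⊎ D ∈ₚ Ax → ∀ Δ {Λ} → Λ ∋ block Δ →
            Closure ∅ (inner Δ) → Closure ∅ Λ
  p-inner a nothing  b x = ∅-up []≤ x
  p-inner a (just φ) b x = absurd (absurd-p a b (∅-derives none x))

  -- Read upwards, rule t copies the content of the block next to it, giving a world above both `Λ`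
  -- and that content.
  t-inner : T ∈ₚ Ax → ∀ {X} Δ {Λ} → Λ ∋ block Δ →
            (∀ {Λ′} → Λ ≤ Λ′ → inner Δ ≤ Λ′ → Closure X Λ′) → Closure X Λ
  t-inner a nothing  b f = f ≤-refl []≤
  t-inner a (just φ) b f =
    expand (grow-t a b) (f ≤-∷ (∷-mono (formula φ) []≤))

  -- The block witnessing □ is played against the block named in `Dia`: rule d when two distinct
  -- blocks have content, rule p when only one does.
  □-seriality : D ∈ₚ Ax → ∀ {X} → Up X → ∀ {Λ} → Box X Λ → Dia X Λ
  □-seriality a up (nothing , _ , x) .toOutput {χ} {Λ₀ = Λ₀} l q h =
    by Λ₀ (blocked χ) (p▹ (inj₂ a)) (sequent-blocked Λ₀ χ) (h x ∷ [])
  □-seriality a up (just φ , b , x) .toOutput {χ} {Λ₀ = Λ₀} l q h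
    with _ , p ← ∋-block-up l b
    with Γ₀ , p₀ , _ ← keep (blocked χ) (λ ()) p q =
    by Λ₀ (blocked χ) (d▹ {Δ = φ •} {Σ = χ °} a)
      (trans (sequent-blocked (block (just φ) ∷ Γ₀) χ)
             (sequent-↭ (blocked χ) (↭-sym p₀)))
      (derivable-resp-↭ (swap _ _ refl) (h x) ∷ [])
  □-seriality a up (nothing , _ , x) .toInput {Δ} l b h =
    p-inner (inj₂ a) Δ b (h ≤-refl (up []≤ x))
  □-seriality a up (just φ , b , x) .toInput {nothing} l b′ h =
    p-inner (inj₂ a) (just φ) (∋-block-up l b) (h []≤ x)
  □-seriality a up (just φ , b , x) .toInput {just ψ} l b′ h
    with _ , p ← ∋-block-up l b
    with _ , p′ ← b′
    with ∷-split (trans (↭-sym p) p′)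
  -- Both blocks are the same occurrence. Its content lies above itself, so a single copy serves
  -- both roles and p applies.
  ... | inj₁ (refl , _) = p-inner (inj₂ a) (just φ) (_ , p) (h ≤-refl x)
  ... | inj₂ (_ , q , _) =
    absurd (absurd-d a (trans p (prep _ q)) (∅-derives none
      (h ≤-∷ (up (∷-mono _ []≤) x))))

  -- On an output block {χ°}, rule t has as premiss the block emptied together with χ°, which is
  -- exactly the world `Λ′` with output χ.
  ◇-reflexivity : T ∈ₚ Ax → ∀ {X} → Up X → ∀ {Λ} → X Λ → Dia X Λ
  ◇-reflexivity a up x .toOutput {χ} {Λ′} {Λ₀} l q h =
    by Λ₀ (blocked χ) (t▹ {Δ = χ °} a) (sequent-blocked Λ₀ χ)
      (derivable-resp-↭ (swap _ _ refl)
         (derives-form {block nothing ∷ Λ₀} (derives-resp-↭ {Π = form χ}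
           (trans q (↭-sym (∷↭∷ʳ _ Λ₀))) (h (up l x)))) ∷ [])
  ◇-reflexivity a up x .toInput {Δ} l b h =
    t-inner a Δ b λ m k → h k (up (≤-trans l m) x)

  -- A block whose content forces φ excludes ¬φ, so `toInput` applies to that block.
  □◇-inconsistency : ∀ φ {Λ} → ⟦ (□ φ ∧ ◇ (~ φ)) ⇒ bot ⟧ᶠ Λ
  □◇-inconsistency φ l (x , y) =
    closure-bind dia-up
      (λ { d (Δ , b , z) →
             d .toInput ≤-refl b λ m f → f ≤-refl (⟦⟧-up φ m z) })
      y x

  top-valid : ∀ {Λ} → ⟦ top ⟧ᶠ Λ
  top-valid _ x = x

  □-top : ∀ {Λ} → Λ ∋ block nothing → ⟦ □ top ⟧ᶠ Λ
  □-top b = base (nothing , b , λ {_} → top-valid)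

  -- Each field of `Dia` comes with a block, and any block makes □⊤ true, so `f` can be applied at
  -- that world.
  □⊤-redundancy : ∀ φ {Λ} → ⟦ (□ top ⇒ ◇ φ) ⇒ ◇ φ ⟧ᶠ Λ
  □⊤-redundancy φ l f .toOutput {Λ₀ = Λ₀} m q h =
    f m (□-top (_ , trans q (↭-sym (∷↭∷ʳ _ Λ₀)))) .toOutput ≤-refl q h
  □⊤-redundancy φ l f .toInput {Δ} m b h =
    f m (base (Δ , b , λ {_} → top-valid)) .toInput ≤-refl b h

  ◇-top : P ∈ₚ Ax → ∀ {Λ} → ⟦ ◇ top ⟧ᶠ Λ
  ◇-top a .toOutput {χ} {Λ₀ = Λ₀} l q h =
    by Λ₀ (blocked χ) (p▹ (inj₁ a)) (sequent-blocked Λ₀ χ)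
      (h {[]} (λ {_} → top-valid) ∷ [])
  ◇-top a .toInput {Δ} l b h =
    p-inner (inj₁ a) Δ b (h ≤-refl (λ {_} → top-valid))

  -- Soundness and the conclusion

  Valid : Formula → Set
  Valid φ = ∀ Λ → ⟦ φ ⟧ᶠ Λ

  -- Quantifying over σ lets the induction pass through uniform substitution, where the two
  -- substitutions are composed.
  sound : ∀ {φ} → Ax ⊢ φ → (σ : ℕ → Formula) → Valid (φ [ σ ])
  sound (K {φ}) σ Λ l x m y = ⟦⟧-up (φ [ σ ]) m x
  sound S σ Λ l f m g n x = f (≤-trans m n) x ≤-refl (g n x)
  sound (∧-intro {φ}) σ Λ l x m y = ⟦⟧-up (φ [ σ ]) m x , y
  sound ∧-fst σ Λ l = proj₁
  sound ∧-snd σ Λ l = proj₂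
  sound ∨-inl σ Λ l x = base (inj₁ x)
  sound ∨-inr σ Λ l x = base (inj₂ x)
  sound (∨-elim {φ} {ψ} {χ}) σ Λ l f m g n x =
    ⟦⟧-closed (χ [ σ ])
      (closure-bind {Y = ⟦ (φ ⇒ χ) ∧ (ψ ⇒ χ) [ σ ] ⟧ᶠ}
        (⟦⟧-up ((φ ⇒ χ) ∧ (ψ ⇒ χ) [ σ ]))
        (λ { (f′ , g′) (inj₁ y) → base (f′ ≤-refl y)
           ; (f′ , g′) (inj₂ y) → base (g′ ≤-refl y) })
        ((λ {_} k → f (≤-trans (≤-trans m n) k)) , (λ {_} k → g (≤-trans n k)))
        x)
  sound (⊥-elim {φ}) σ Λ l x = ⟦⟧-closed (φ [ σ ]) (∅-elim x)
  sound (□◇-neg {φ}) σ Λ = □◇-inconsistency (φ [ σ ]) {Λ}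
  sound (□◇-top {φ}) σ Λ = □⊤-redundancy (φ [ σ ]) {Λ}
  sound (axN a) σ Λ = expand (grow-n a) (□-top (Λ , refl))
  sound (axP a) σ Λ = ◇-top a
  sound (axD {φ} a) σ Λ l x =
    ⟦⟧-closed (◇ φ [ σ ])
      (closure-join (base ∘ □-seriality a (⟦⟧-up (φ [ σ ]))) x)
  sound (axT {φ} a) σ Λ =
    (λ _ x → ⟦⟧-closed (φ [ σ ])
      (closure-join
        (λ { (Δ , b , y) → t-inner a Δ b λ _ k →
               base (⟦⟧-up (φ [ σ ]) k y) }) x)) ,
    (λ _ x → ◇-reflexivity a (⟦⟧-up (φ [ σ ])) x)
  sound (mp d e) σ Λ = sound d σ Λ ≤-refl (sound e σ Λ)
  sound (□-mono d) σ Λ l =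
    closure-join λ { (Δ , b , x) →
      -- Validity is used at the content of the block, a world that need not lie above `Λ`.
      base (Δ , b , sound d σ (inner Δ) ≤-refl x) }
  sound (◇-mono d) σ Λ l x .toOutput m q h =
    x .toOutput m q λ {Θ} y → h (sound d σ Θ ≤-refl y)
  sound (◇-mono d) σ Λ l x .toInput m b h =
    x .toInput m b λ {Θ} k y → h k (sound d σ Θ ≤-refl y)
  sound (usub {φ} τ d) σ =
    subst Valid (sym ([]-assoc φ)) (sound d (λ p → τ p [ σ ]))
    where
    []-assoc : ∀ φ → φ [ τ ] [ σ ] ≡ φ [ (λ p → τ p [ σ ]) ]
    []-assoc (var p) = refl
    []-assoc bot     = refl
    []-assoc (φ ∧ ψ) = cong₂ _∧_ ([]-assoc φ) ([]-assoc ψ)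
    []-assoc (φ ∨ ψ) = cong₂ _∨_ ([]-assoc φ) ([]-assoc ψ)
    []-assoc (φ ⇒ ψ) = cong₂ _⇒_ ([]-assoc φ) ([]-assoc ψ)
    []-assoc (□ φ)   = cong □_ ([]-assoc φ)
    []-assoc (◇ φ)   = cong ◇_ ([]-assoc φ)

[]-identity : ∀ φ → φ [ var ] ≡ φ
[]-identity (var p) = refl
[]-identity bot     = refl
[]-identity (φ ∧ ψ) = cong₂ _∧_ ([]-identity φ) ([]-identity ψ)
[]-identity (φ ∨ ψ) = cong₂ _∨_ ([]-identity φ) ([]-identity ψ)
[]-identity (φ ⇒ ψ) = cong₂ _⇒_ ([]-identity φ) ([]-identity ψ)
[]-identity (□ φ)   = cong □_ ([]-identity φ)
[]-identity (◇ φ)   = cong ◇_ ([]-identity φ)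

theorem4p7 : (Ax : Pred Axiom 0ℓ) (φ : Formula) → Ax ⊢ φ → Derivable Ax ([] ▸ ‹ φ ° ›)
-- The empty world has no inputs, so its sequent is φ° alone.
theorem4p7 Ax φ d = reify φ (subst Valid ([]-identity φ) (sound d var) [])
  where open Model Ax
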